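{- In intensional Martin-Löf type theory with weak propositional truncation, let $X,Y:\mathcal U$ and $f:X\to Y$ with $\prod_{x,y:X}f(x)=f(y)$. If $Y$ is a set (i.e. $\prod_{y_1,y_2:Y}\mathrm{isProp}(y_1=y_2)$), then $f$ factors through $\lVert X\rVert$: there is $\bar f:\lVert X\rVert\to Y$ with $\prod_{x:X}\bar f(|x|)=f(x)$.
   Context: Intensional Martin-Löf type theory with a universe $\mathcal U$, $\Sigma$, $\Pi$, $+$ and identity types (J only; no UIP/K). $\mathrm{isProp}(A):\equiv\prod_{a,b:A}a=b$. Weak propositional truncation: for every $A:\mathcal U$ a type $\lVert A\rVert:\mathcal U$ with $|{ - }|:A\to\lVert A\rVert$, a proof of $\mathrm{isProp}(\lVert A\rVert)$, and $\mathrm{rec}:\prod_{P:\mathcal U}\mathrm{isProp}(P)\to(A\to P)\to\lVert A\rVert\to P$ (no judgmental computation rule). -}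

{-# OPTIONS --without-K #-}
module Defs where

open import Relation.Binary.PropositionalEquality using (_≡_)

isProp : Set → Set
isProp A = (a b : A) → a ≡ b

isSet : Set → Set
isSet Y = (y₁ y₂ : Y) → isProp (y₁ ≡ y₂)

wconst : {X Y : Set} → (X → Y) → Set
wconst {X} f = (x y : X) → f x ≡ f y

-- Weak propositional truncation (as an assumed structure on the universe Set):
-- a type ∥A∥ : Set for every A : Set, |-| : A → ∥A∥, isProp ∥A∥, and the
-- (non-dependent) recursor into propositions, with no computation rule.
record WeakTruncation : Set₁ where
  field
    ∥_∥   : Set → Set
    ∣_∣   : {A : Set} → A → ∥ A ∥
    ∥∥-isProp : (A : Set) → isProp ∥ A ∥
    rec   : {A : Set} → (P : Set) → isProp P → (A → P) → ∥ A ∥ → P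

module Submission where

-- The image  Σ (y : Y), ∥ fiber f y ∥  of a weakly constant map into a set is
-- a proposition: two of its points have equal first components because the
-- fibers are inhabited (merely, which suffices as  y ≡ y'  is a proposition),
-- and the second components live in a proposition.  So ∥ X ∥ maps into the
-- image by the recursor, and  f̄  is the first projection of that map.

open import Defs
open import Data.Product using (Σ; _,_; proj₁)
open import Relation.Binary.PropositionalEquality using (_≡_; refl; sym; trans; cong)

Σ-≡-prop : {A : Set} {B : A → Set} → ((a : A) → isProp (B a))
         → {a a' : A} (b : B a) (b' : B a') → a ≡ a' → _≡_ {A = Σ A B} (a , b) (a' , b')
Σ-≡-prop isPropB {a} b b' refl = cong (a ,_) (isPropB a b b')

fiber : {X Y : Set} → (X → Y) → Y → Set
fiber {X} f y = Σ X (λ x → f x ≡ y)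

wconst-fiber-≡ : {X Y : Set} {f : X → Y} → wconst f → {y y' : Y} → fiber f y → fiber f y' → y ≡ y'
wconst-fiber-≡ wc (x , fx≡y) (x' , fx'≡y') = trans (sym fx≡y) (trans (wc x x') fx'≡y')

module _ (T : WeakTruncation) where
  open WeakTruncation T

  rec₂ : {A B : Set} (P : Set) → isProp P → (A → B → P) → ∥ A ∥ → ∥ B ∥ → P
  rec₂ P isPropP h s t = rec P isPropP (λ a → rec P isPropP (h a) t) s

  rec-∣∣ : {A : Set} (P : Set) (isPropP : isProp P) (h : A → P) (a : A) → rec P isPropP h ∣ a ∣ ≡ h a
  rec-∣∣ P isPropP h a = isPropP _ _

  Image : {X Y : Set} → (X → Y) → Set
  Image {Y = Y} f = Σ Y (λ y → ∥ fiber f y ∥)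

  wconst-Image-isProp : {X Y : Set} (f : X → Y) → wconst f → isSet Y → isProp (Image f)
  wconst-Image-isProp f wc isSetY (y , s) (y' , s') =
    Σ-≡-prop (λ y → ∥∥-isProp (fiber f y)) s s'
      (rec₂ (y ≡ y') (isSetY y y') (wconst-fiber-≡ wc) s s')

theorem5p4 : (T : WeakTruncation) → (X Y : Set) → (f : X → Y) → wconst f → isSet Y
    → Σ (WeakTruncation.∥_∥ T X → Y) (λ fbar → (x : X) → fbar (WeakTruncation.∣_∣ T x) ≡ f x)
theorem5p4 T X Y f wc isSetY =
  (λ t → proj₁ (toImage t)) , (λ x → cong proj₁ (rec-∣∣ T _ isPropImage corestrict x))
  where
  open WeakTruncation T

  isPropImage : isProp (Image T f)
  isPropImage = wconst-Image-isProp T f wc isSetY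

  corestrict : X → Image T f
  corestrict x = f x , ∣ x , refl ∣

  toImage : ∥ X ∥ → Image T f
  toImage = rec (Image T f) isPropImage corestrict
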